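{- The number $R_3(L)$ satisfies $R_3(L) \leq 1804$.
   Context: For a positive integer $n$, the $n \times n$ integer grid is $[n]\times[n]=\{(i,j): 1\le i,j\le n\}$, where $(i,j)$ is the point in row $i$ (rows counted downward) and column $j$ (columns counted left to right). Given a coloring of $[n]\times[n]$ with $k$ colors (an arbitrary map from $[n]\times[n]$ to a set of $k$ colors), a monochromatic $L$ is a set of three points $\{(x,y),(x+d,y),(x+d,y+d)\}\subseteq [n]\times[n]$, with $d$ a positive integer, all having the same color. For a positive integer $k$, $R_k(L)$ denotes the least positive integer $n$ such that every $k$-coloring of $[n]\times[n]$ contains a monochromatic $L$ (it exists by the Gallai-Witt theorem). -}

module Defs where

open import Data.Fin.Base using (Fin; toℕ)
open import Data.Nat.Base using (ℕ; _+_; _≤_; _<_)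
open import Data.Product.Base using (_×_; _,_)
open import Relation.Binary.PropositionalEquality.Core using (_≡_)

-- Coordinates are 0-based; the notion of an L is translation invariant, so
-- this is the grid {1,…,n} × {1,…,n} up to a shift.
Grid : ℕ → Set
Grid n = Fin n × Fin n

Coloring : ℕ → ℕ → Set
Coloring k n = Grid n → Fin k

-- The three points are (x , y), (x + d , y), (x + d , y + d); the coordinates
-- x′ = x + d and y′ = y + d being in Fin n says that they lie in the grid.
record MonochromaticL {k n : ℕ} (χ : Coloring k n) : Set where
  field
    x y x′ y′ : Fin n
    d         : ℕ
    d>0       : 0 < d
    x′≡x+d    : toℕ x′ ≡ toℕ x + d
    y′≡y+d    : toℕ y′ ≡ toℕ y + d
    color₁₂   : χ (x , y) ≡ χ (x′ , y)
    color₂₃   : χ (x′ , y) ≡ χ (x′ , y′)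

ForcesL : ℕ → ℕ → Set
ForcesL k n = (χ : Coloring k n) → MonochromaticL χ

-- "R_k(L) = r", as a relation since R_k(L) is defined as a minimum.
record IsR (k r : ℕ) : Set where
  field
    positive : 0 < r
    forces   : ForcesL k r
    least    : ∀ n → 0 < n → ForcesL k n → r ≤ n

{-# OPTIONS --safe #-}
-- Let A be the majority color class of the bottom row, with color ρ.  For each
-- d > 0 consider the columns y with y and y + d both in A: without an L, the
-- cell at height d in such a column has one of the other two colors.  Let S be
-- the set of those columns where that color is β, and let γ be the third color.
-- For u < v in S, the cell in column u at height d + (v − u) is neither ρ nor β,
-- hence γ.  So if u < v in S and u + e, v + e in S, three such cells form an L of
-- color γ: all the differences of S are distinct, and |S|² ≤ |S| + 2 (n − d).
-- Since (|S| − c)(|S| − c − 1) ≥ 0, this gives 2 c |S| ≤ 2 (n − d) + c (c + 1) for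
-- every c.  Summing over d and both colors β bounds the number of pairs in A;
-- with c = 42 ≈ √n this contradicts |A| ≥ n / 3 for n = 1804.
module Submission where

open import Data.Empty using (⊥-elim)
open import Data.Fin.Base using (Fin; toℕ; finToFun; funToFin; combine; remQuot)
open import Data.Fin.Patterns using (0F; 1F; 2F)
open import Data.Fin.Properties
  using (toℕ-fromℕ<; any?; all?; finToFun-funToFin; remQuot-combine)
  renaming (_≟_ to _≟ᶠ_)
open import Data.Nat.Base using (ℕ; zero; suc; _+_; _*_; _∸_; _^_; _≤_; _<_; z≤n; s≤s; s≤s⁻¹; z<s)
open import Data.Nat.DivMod using (_mod_; m%n<n; m<n⇒m%n≡m)
open import Data.Nat.Properties
open import Data.Nat.Tactic.RingSolver using (solve-∀)
open import Data.Product.Base using (_×_; _,_; ∃-syntax; uncurry)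
open import Data.Sum.Base using (_⊎_; inj₁; inj₂)
open import Function.Base using (_∘_)
open import Relation.Binary.PropositionalEquality
  using (_≡_; refl; sym; trans; cong; cong₂; subst; module ≡-Reasoning)
open import Relation.Nullary using (Dec; yes; no; ¬_; contradiction)
open import Relation.Nullary.Decidable using (_×-dec_; map′; decidable-stable)
open import Algebra.Properties.Semiring.Sum +-*-semiring
  using (sum; sum-cong-≗; ∑-distrib-+; *-distribˡ-sum)
open import Defs

-- Finite sums over initial segments of the naturals.

∑ : ℕ → (ℕ → ℕ) → ℕ
∑ n f = sum {n} (f ∘ toℕ)

∑-cong : ∀ n {f g} → (∀ i → f i ≡ g i) → ∑ n f ≡ ∑ n g
∑-cong n f≡g = sum-cong-≗ {n} (f≡g ∘ toℕ)

∑-+ : ∀ n f g → ∑ n (λ i → f i + g i) ≡ ∑ n f + ∑ n g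
∑-+ n f g = ∑-distrib-+ {n} (f ∘ toℕ) (g ∘ toℕ)

∑-* : ∀ n c f → c * ∑ n f ≡ ∑ n (λ i → c * f i)
∑-* n c f = *-distribˡ-sum {n} c (f ∘ toℕ)

∑-const : ∀ n c → ∑ n (λ _ → c) ≡ n * c
∑-const zero    c = refl
∑-const (suc n) c = cong (c +_) (∑-const n c)

∑-mono-≤ : ∀ n {f g} → (∀ i → i < n → f i ≤ g i) → ∑ n f ≤ ∑ n g
∑-mono-≤ zero    f≤g = z≤n
∑-mono-≤ (suc n) f≤g = +-mono-≤ (f≤g 0 z<s) (∑-mono-≤ n λ i i<n → f≤g (suc i) (s≤s i<n))

-- The sum of f i e over i + e < n, arranged by e, and its splitting by i = 0 or i > 0.
∑-triangle : ∀ n (f : ℕ → ℕ → ℕ) →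
  ∑ (suc n) (λ e → ∑ (n ∸ e) (λ i → f i e)) ≡
  ∑ n (f 0) + ∑ n (λ e → ∑ (n ∸ suc e) (λ i → f (suc i) e))
∑-triangle zero    f = refl
∑-triangle (suc n) f = begin
  (f 0 0 + c) + ∑ (suc n) (λ e → ∑ (n ∸ e) (λ i → f i (suc e)))
    ≡⟨ cong ((f 0 0 + c) +_) (∑-triangle n (λ i e → f i (suc e))) ⟩
  (f 0 0 + c) + (r + t)
    ≡⟨ interchange (f 0 0) c r t ⟩
  (f 0 0 + r) + (c + t) ∎
  where
  open ≡-Reasoning
  c r t : ℕ
  c = ∑ n (λ i → f (suc i) 0)
  r = ∑ n (λ e → f 0 (suc e))
  t = ∑ n (λ e → ∑ (n ∸ suc e) (λ i → f (suc i) (suc e)))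
  interchange : ∀ w x y z → (w + x) + (y + z) ≡ (w + y) + (x + z)
  interchange = solve-∀

-- Indicators and counting.

𝟙 : {P : Set} → Dec P → ℕ
𝟙 (yes _) = 1
𝟙 (no  _) = 0

1≤𝟙 : {P : Set} (P? : Dec P) → P → 1 ≤ 𝟙 P?
1≤𝟙 (yes _) _ = ≤-refl
1≤𝟙 (no ¬p) p = contradiction p ¬p

𝟙-idem : {P : Set} (P? : Dec P) → 𝟙 P? * 𝟙 P? ≡ 𝟙 P?
𝟙-idem (yes _) = refl
𝟙-idem (no  _) = refl

𝟙-× : {P Q : Set} (P? : Dec P) (Q? : Dec Q) → 𝟙 (P? ×-dec Q?) ≡ 𝟙 P? * 𝟙 Q?
𝟙-× (yes _) (yes _) = refl
𝟙-× (yes _) (no  _) = refl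
𝟙-× (no  _) _       = refl

𝟙-≤-+ : {P Q R : Set} (P? : Dec P) (Q? : Dec Q) (R? : Dec R) →
        (P → Q ⊎ R) → 𝟙 P? ≤ 𝟙 Q? + 𝟙 R?
𝟙-≤-+ (no _)  Q? R? f = z≤n
𝟙-≤-+ (yes p) Q? R? f with f p
... | inj₁ q = ≤-trans (1≤𝟙 Q? q) (m≤m+n _ _)
... | inj₂ r = ≤-trans (1≤𝟙 R? r) (m≤n+m _ _)

count : {P : ℕ → Set} → (∀ i → Dec (P i)) → ℕ → ℕ
count P? n = ∑ n (λ i → 𝟙 (P? i))

-- Pairs in a set, sorted by distance.

AtDistance : (ℕ → Set) → ℕ → ℕ → Set
AtDistance P e i = P i × P (i + suc e)

atDistance? : {P : ℕ → Set} → (∀ i → Dec (P i)) → ∀ e i → Dec (AtDistance P e i)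
atDistance? P? e i = P? i ×-dec P? (i + suc e)

-- The square counts ordered pairs: the diagonal, and each pair `i < j` twice. The index `e` stands
-- for the distance `e + 1`. The induction splits off the point 0, whose pairs number `a * s`;
-- `∑-triangle` merges them with the pairs of the rest.
pairs-by-distance : {P : ℕ → Set} (P? : ∀ i → Dec (P i)) (n : ℕ) →
  count P? n * count P? n ≡
  count P? n + 2 * ∑ n (λ e → count (atDistance? P? e) (n ∸ suc e))
pairs-by-distance P? zero    = refl
pairs-by-distance P? (suc n) = begin
  (a + s) * (a + s)
    ≡⟨ square a s ⟩
  a * a + (s * s + 2 * (a * s))
    ≡⟨ cong₂ (λ x y → x + (y + 2 * (a * s))) (𝟙-idem (P? 0)) (pairs-by-distance (P? ∘ suc) n) ⟩
  a + ((s + 2 * t) + 2 * (a * s))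
    ≡⟨ regroup a s t (a * s) ⟩
  (a + s) + 2 * (a * s + t)
    ≡⟨ cong (λ x → (a + s) + 2 * (x + t)) a*s≡ ⟩
  (a + s) + 2 * (∑ n (λ e → 𝟙 (atDistance? P? e 0)) + t)
    ≡⟨ cong (λ x → (a + s) + 2 * x) (∑-triangle n (λ i e → 𝟙 (atDistance? P? e i))) ⟨
  (a + s) + 2 * ∑ (suc n) (λ e → count (atDistance? P? e) (n ∸ e)) ∎
  where
  open ≡-Reasoning
  a s t : ℕ
  a = 𝟙 (P? 0)
  s = count (P? ∘ suc) n
  t = ∑ n (λ e → count (atDistance? (P? ∘ suc) e) (n ∸ suc e))
  a*s≡ : a * s ≡ ∑ n (λ e → 𝟙 (atDistance? P? e 0))
  a*s≡ = trans (∑-* n a (λ e → 𝟙 (P? (suc e)))) (∑-cong n λ e → sym (𝟙-× (P? 0) (P? (suc e))))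
  square : ∀ a s → (a + s) * (a + s) ≡ a * a + (s * s + 2 * (a * s))
  square = solve-∀
  regroup : ∀ a s t p → a + ((s + 2 * t) + 2 * p) ≡ (a + s) + 2 * (p + t)
  regroup = solve-∀

count-≤-+ : {P Q R : ℕ → Set} (P? : ∀ i → Dec (P i)) (Q? : ∀ i → Dec (Q i))
  (R? : ∀ i → Dec (R i)) (n : ℕ) → (∀ i → i < n → P i → Q i ⊎ R i) →
  count P? n ≤ count Q? n + count R? n
count-≤-+ P? Q? R? n f = subst (count P? n ≤_)
  (∑-+ n (λ i → 𝟙 (Q? i)) (λ i → 𝟙 (R? i)))
  (∑-mono-≤ n λ i i<n → 𝟙-≤-+ (P? i) (Q? i) (R? i) (f i i<n))

count-none : {P : ℕ → Set} (P? : ∀ i → Dec (P i)) (n : ℕ) →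
  (∀ i → i < n → ¬ P i) → count P? n ≡ 0
count-none P? zero    none = refl
count-none P? (suc n) none with P? 0
... | yes p = contradiction p (none 0 z<s)
... | no  _ = count-none (P? ∘ suc) n λ i i<n → none (suc i) (s≤s i<n)

count≤1 : {P : ℕ → Set} (P? : ∀ i → Dec (P i)) (n : ℕ) →
  (∀ i t → i + suc t < n → P i → ¬ P (i + suc t)) → count P? n ≤ 1
count≤1 P? zero    unique = z≤n
count≤1 P? (suc n) unique with P? 0
... | yes p = ≤-reflexive (cong suc (count-none (P? ∘ suc) n λ i i<n → unique 0 i (s≤s i<n) p))
... | no  _ = count≤1 (P? ∘ suc) n λ i t lt → unique (suc i) t (s≤s lt)

-- This is `pairs-by-distance` for the full set, where `n ∸ suc d` pairs have distance `d + 1`.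
∑-range : ∀ n → n * n ≡ n + 2 * ∑ n (λ d → n ∸ suc d)
∑-range zero    = refl
∑-range (suc n) = begin
  suc n * suc n                     ≡⟨ square n ⟩
  suc n + (n + n * n)               ≡⟨ cong (λ x → suc n + (n + x)) (∑-range n) ⟩
  suc n + (n + (n + 2 * t))         ≡⟨ regroup n t ⟩
  suc n + 2 * (n + t)               ∎
  where
  open ≡-Reasoning
  t : ℕ
  t = ∑ n (λ d → n ∸ suc d)
  square : ∀ n → suc n * suc n ≡ suc n + (n + n * n)
  square = solve-∀
  regroup : ∀ n t → suc n + (n + (n + 2 * t)) ≡ suc n + 2 * (n + t)
  regroup = solve-∀

-- Expands (s − c)(s − c − 1) ≥ 0.
square-tangent : ∀ c s → (2 * c + 1) * s ≤ s * s + c * (c + 1)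
square-tangent c s with ≤-<-connex s c
... | inj₁ s≤c with t , refl ← m≤n⇒∃[o]m+o≡n s≤c = m+n≤o⇒m≤o _ (≤-reflexive (below s t))
  where
  below : ∀ s t → (2 * (s + t) + 1) * s + (t * t + t) ≡ s * s + (s + t) * (s + t + 1)
  below = solve-∀
... | inj₂ c<s with t , refl ← m≤n⇒∃[o]m+o≡n c<s = m+n≤o⇒m≤o _ (≤-reflexive (above c t))
  where
  above : ∀ c t → (2 * c + 1) * (suc c + t) + (t * t + t) ≡
                  (suc c + t) * (suc c + t) + c * (c + 1)
  above = solve-∀

-- Sets with distinct differences.

i<n∸k⇒i+k<n : ∀ {i} n k → i < n ∸ k → i + k < n
i<n∸k⇒i+k<n {i} n       zero    lt = subst (_< n) (sym (+-identityʳ i)) lt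
i<n∸k⇒i+k<n {i} (suc n) (suc k) lt = subst (_< suc n) (sym (+-suc i k)) (s≤s (i<n∸k⇒i+k<n n k lt))

-- Each distance occurs at most once, so `T ≤ m`. The tangent makes the resulting quadratic bound
-- linear in the count, ready to be summed over distances.
distinct-differences⇒count-≤ : {P : ℕ → Set} (P? : ∀ i → Dec (P i)) (c m : ℕ) →
  (∀ e i t → i + suc t + suc e < m → AtDistance P e i → ¬ AtDistance P e (i + suc t)) →
  2 * c * count P? m ≤ 2 * m + c * (c + 1)
-- The odd coefficient `2 * c + 1` of the tangent absorbs the diagonal term `s`.
distinct-differences⇒count-≤ P? c m distinct = +-cancelʳ-≤ s _ _ (begin
  2 * c * s + s                    ≡⟨ lhs c s ⟩
  (2 * c + 1) * s                  ≤⟨ square-tangent c s ⟩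
  s * s + c * (c + 1)              ≡⟨ cong (_+ c * (c + 1)) (pairs-by-distance P? m) ⟩
  (s + 2 * T) + c * (c + 1)        ≤⟨ +-monoˡ-≤ _ (+-monoʳ-≤ s (*-monoʳ-≤ 2 T≤m)) ⟩
  (s + 2 * m) + c * (c + 1)        ≡⟨ rhs s m (c * (c + 1)) ⟩
  2 * m + c * (c + 1) + s          ∎)
  where
  open ≤-Reasoning
  s T : ℕ
  s = count P? m
  T = ∑ m (λ e → count (atDistance? P? e) (m ∸ suc e))
  T≤m : T ≤ m
  T≤m = begin
    T                ≤⟨ ∑-mono-≤ m (λ e _ → count≤1 (atDistance? P? e) (m ∸ suc e)
                          λ i t lt → distinct e i t (i<n∸k⇒i+k<n m (suc e) lt)) ⟩
    ∑ m (λ _ → 1)    ≡⟨ ∑-const m 1 ⟩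
    m * 1            ≡⟨ *-identityʳ m ⟩
    m                ∎
  lhs : ∀ c s → 2 * c * s + s ≡ (2 * c + 1) * s
  lhs = solve-∀
  rhs : ∀ s m x → (s + 2 * m) + x ≡ 2 * m + x + s
  rhs = solve-∀

-- Colorings without a monochromatic L.

Covers : {k : ℕ} → Fin k → Fin k → Fin k → Set
Covers {k} α β γ = (c : Fin k) → c ≡ α ⊎ c ≡ β ⊎ c ≡ γ

Covers-swap : {k : ℕ} {α β γ : Fin k} → Covers α β γ → Covers α γ β
Covers-swap cover c with cover c
... | inj₁ c≡α        = inj₁ c≡α
... | inj₂ (inj₁ c≡β) = inj₂ (inj₂ c≡β)
... | inj₂ (inj₂ c≡γ) = inj₂ (inj₁ c≡γ)

-- K h y is the color of the cell at height h above the bottom row, in column y.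
module NoL {k n : ℕ} (K : ℕ → ℕ → Fin k)
  (noL : ∀ h y d → h + suc d < n → y + suc d < n →
         K (h + suc d) y ≡ K h y → ¬ (K h y ≡ K h (y + suc d)))
  where

  Bottom : Fin k → ℕ → Set
  Bottom ρ y = K 0 y ≡ ρ

  bottom? : ∀ ρ y → Dec (Bottom ρ y)
  bottom? ρ y = K 0 y ≟ᶠ ρ

  -- The set S of the opening comment, for height `suc d`.
  Above : Fin k → Fin k → ℕ → ℕ → Set
  Above ρ β d y = AtDistance (Bottom ρ) d y × K (suc d) y ≡ β

  above? : ∀ ρ β d y → Dec (Above ρ β d y)
  above? ρ β d y = atDistance? (bottom? ρ) d y ×-dec (K (suc d) y ≟ᶠ β)

  -- Otherwise this cell, the bottom cell under it and the bottom cell `suc d` columns to the right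
  -- form an L of color `ρ`.
  above-≢ : ∀ ρ d y → y + suc d < n → AtDistance (Bottom ρ) d y → ¬ (K (suc d) y ≡ ρ)
  above-≢ ρ d y lt (p , q) r =
    noL 0 y d (≤-<-trans (m≤n+m _ y) lt) lt (trans r (sym p)) (trans p (sym q))

  -- Color `β` would complete an L with the cells at height `suc d` in columns `u` and `u + suc t`.
  -- Color `ρ` would complete one with the bottom cells in columns `u` and `u + suc t + suc d`.
  third-color : ∀ {ρ β γ} → Covers ρ β γ → ∀ d u t → u + suc t + suc d < n →
    Above ρ β d u → Above ρ β d (u + suc t) → K (suc d + suc t) u ≡ γ
  third-color {ρ} cover d u t lt ((p , _) , b) ((_ , q) , b′) with cover (K (suc d + suc t) u)
  ... | inj₂ (inj₂ ≡γ) = ≡γ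
  ... | inj₂ (inj₁ ≡β) = ⊥-elim (noL (suc d) u t
        -- The grid is square, so the bound on the rightmost column also bounds the height.
        (≤-<-trans (≤-trans (m≤n+m _ u) (≤-reflexive (rearrange u t d))) lt)
        (≤-<-trans (m≤m+n _ _) lt)
        (trans ≡β (sym b)) (trans b (sym b′)))
    where
    rearrange : ∀ u t d → u + (suc d + suc t) ≡ u + suc t + suc d
    rearrange = solve-∀
  ... | inj₁ ≡ρ = ⊥-elim (above-≢ ρ (d + suc t) u (subst (_< n) (sym far) lt)
        (p , subst (λ y → K 0 y ≡ ρ) (sym far) q) ≡ρ)
    where
    rearrange : ∀ u t d → u + suc (d + suc t) ≡ u + suc t + suc d
    rearrange = solve-∀
    far : u + suc (d + suc t) ≡ u + suc t + suc d
    far = rearrange u t d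

  -- `third-color` is applied to three pairs of columns: `u` with `u + suc t + suc e` gives the top
  -- of an L, `u` with `u + suc t` its corner, and `u + suc e` with `u + suc e + suc t` its right
  -- end. The last two pairs have equal difference, hence equal height.
  above-distinct-differences : ∀ {ρ β γ} → Covers ρ β γ → ∀ d e u t →
    u + suc t + suc e < n ∸ suc d →
    AtDistance (Above ρ β d) e u → ¬ AtDistance (Above ρ β d) e (u + suc t)
  above-distinct-differences {ρ} {β} {γ} cover d e u t lt (a , b) (a′ , b′) =
    noL (suc d + suc t) u e
      (≤-<-trans (≤-trans (m≤n+m _ u) (≤-reflexive (height u d t e))) lt′)
      (≤-<-trans (≤-trans (m≤n+m _ (suc t + suc d)) (≤-reflexive (column u d t e))) lt′)
      (trans top (sym corner)) (trans corner (sym right))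
    where
    height : ∀ u d t e → u + (suc d + suc t + suc e) ≡ u + suc t + suc e + suc d
    height = solve-∀
    column : ∀ u d t e → (suc t + suc d) + (u + suc e) ≡ u + suc t + suc e + suc d
    column = solve-∀
    near : ∀ u d t e → suc e + (u + suc t + suc d) ≡ u + suc t + suc e + suc d
    near = solve-∀
    split : ∀ u t e → u + suc t + suc e ≡ u + suc (t + suc e)
    split = solve-∀
    swap : ∀ u t e → u + suc t + suc e ≡ u + suc e + suc t
    swap = solve-∀
    sum-height : ∀ d t e → suc d + suc (t + suc e) ≡ suc d + suc t + suc e
    sum-height = solve-∀
    lt′ : u + suc t + suc e + suc d < n
    lt′ = i<n∸k⇒i+k<n n (suc d) lt
    top : K (suc d + suc t + suc e) u ≡ γ
    top = subst (λ h → K h u ≡ γ) (sum-height d t e)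
      (third-color cover d u (t + suc e) (subst (λ v → v + suc d < n) (split u t e) lt′)
        a (subst (Above ρ β d) (split u t e) b′))
    corner : K (suc d + suc t) u ≡ γ
    corner = third-color cover d u t
      (≤-<-trans (≤-trans (m≤n+m _ (suc e)) (≤-reflexive (near u d t e))) lt′) a a′
    right : K (suc d + suc t) (u + suc e) ≡ γ
    right = third-color cover d (u + suc e) t
      (subst (λ v → v + suc d < n) (swap u t e) lt′) b (subst (Above ρ β d) (swap u t e) b′)

  bottom-pairs-≤ : ∀ {ρ β γ} → Covers ρ β γ → ∀ c d →
    2 * c * count (atDistance? (bottom? ρ) d) (n ∸ suc d) ≤
    4 * (n ∸ suc d) + 2 * (c * (c + 1))
  bottom-pairs-≤ {ρ} {β} {γ} cover c d = begin
    2 * c * count (atDistance? (bottom? ρ) d) m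
      ≤⟨ *-monoʳ-≤ (2 * c)
           (count-≤-+ (atDistance? (bottom? ρ) d) (above? ρ β d) (above? ρ γ d) m color) ⟩
    2 * c * (count (above? ρ β d) m + count (above? ρ γ d) m)
      ≡⟨ *-distribˡ-+ (2 * c) (count (above? ρ β d) m) (count (above? ρ γ d) m) ⟩
    2 * c * count (above? ρ β d) m + 2 * c * count (above? ρ γ d) m
      ≤⟨ +-mono-≤
           (distinct-differences⇒count-≤ (above? ρ β d) c m (above-distinct-differences cover d))
           (distinct-differences⇒count-≤ (above? ρ γ d) c m
             (above-distinct-differences (Covers-swap cover) d)) ⟩
    (2 * m + c * (c + 1)) + (2 * m + c * (c + 1))
      ≡⟨ double m (c * (c + 1)) ⟩
    4 * m + 2 * (c * (c + 1)) ∎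
    where
    open ≤-Reasoning
    m : ℕ
    m = n ∸ suc d
    color : ∀ y → y < m → AtDistance (Bottom ρ) d y → Above ρ β d y ⊎ Above ρ γ d y
    color y y<m p with cover (K (suc d) y)
    ... | inj₁ ≡ρ        = contradiction ≡ρ (above-≢ ρ d y (i<n∸k⇒i+k<n n (suc d) y<m) p)
    ... | inj₂ (inj₁ ≡β) = inj₁ (p , ≡β)
    ... | inj₂ (inj₂ ≡γ) = inj₂ (p , ≡γ)
    double : ∀ m x → (2 * m + x) + (2 * m + x) ≡ 4 * m + 2 * x
    double = solve-∀

  -- The per-distance bounds are summed over `d`. The term `2 * n` on the left completes `4 * D` to
  -- `2 * (n * n)` by `∑-range`.
  bottom-square-≤ : ∀ {ρ β γ} → Covers ρ β γ → ∀ c →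
    let r = count (bottom? ρ) n in
    c * (r * r) + 2 * n ≤ c * r + (2 * (n * n) + n * (2 * (c * (c + 1))))
  bottom-square-≤ {ρ} cover c = begin
    c * (r * r) + 2 * n
      ≡⟨ cong (λ x → c * x + 2 * n) (pairs-by-distance (bottom? ρ) n) ⟩
    c * (r + 2 * T) + 2 * n
      ≡⟨ expand c r T n ⟩
    c * r + (2 * c * T + 2 * n)
      ≡⟨ cong (λ x → c * r + (x + 2 * n)) (∑-* n (2 * c) pairs) ⟩
    c * r + (∑ n (λ d → 2 * c * pairs d) + 2 * n)
      ≤⟨ +-monoʳ-≤ (c * r) (+-monoˡ-≤ (2 * n) (∑-mono-≤ n λ d _ → bottom-pairs-≤ cover c d)) ⟩
    c * r + (∑ n (λ d → 4 * (n ∸ suc d) + x) + 2 * n)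
      ≡⟨ cong (λ y → c * r + (y + 2 * n)) (∑-+ n (λ d → 4 * (n ∸ suc d)) (λ _ → x)) ⟩
    c * r + (∑ n (λ d → 4 * (n ∸ suc d)) + ∑ n (λ _ → x) + 2 * n)
      ≡⟨ cong₂ (λ y z → c * r + (y + z + 2 * n))
           (sym (∑-* n 4 (λ d → n ∸ suc d))) (∑-const n x) ⟩
    c * r + (4 * D + n * x + 2 * n)
      ≡⟨ collect (c * r) D n x ⟩
    c * r + (2 * (n + 2 * D) + n * x)
      ≡⟨ cong (λ y → c * r + (2 * y + n * x)) (∑-range n) ⟨
    c * r + (2 * (n * n) + n * x) ∎
    where
    open ≤-Reasoning
    pairs : ℕ → ℕ
    pairs d = count (atDistance? (bottom? ρ) d) (n ∸ suc d)
    r T D x : ℕ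
    r = count (bottom? ρ) n
    T = ∑ n pairs
    D = ∑ n (λ d → n ∸ suc d)
    x = 2 * (c * (c + 1))
    expand : ∀ c r T n → c * (r + 2 * T) + 2 * n ≡ c * r + (2 * c * T + 2 * n)
    expand = solve-∀
    collect : ∀ y D n x → y + (4 * D + n * x + 2 * n) ≡ y + (2 * (n + 2 * D) + n * x)
    collect = solve-∀

-- A majority color of the bottom row.

module _ {n : ℕ} (K : ℕ → ℕ → Fin 3) where

  row-count : Fin 3 → ℕ
  row-count ρ = count (λ y → K 0 y ≟ᶠ ρ) n

  row-counts : n ≤ row-count 0F + (row-count 1F + row-count 2F)
  row-counts = begin
    n                ≡⟨ *-identityʳ n ⟨
    n * 1            ≡⟨ ∑-const n 1 ⟨
    ∑ n (λ _ → 1)    ≤⟨ ∑-mono-≤ n (λ y _ → one (K 0 y)) ⟩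
    ∑ n (λ y → 𝟙 (K 0 y ≟ᶠ 0F) + (𝟙 (K 0 y ≟ᶠ 1F) + 𝟙 (K 0 y ≟ᶠ 2F)))
                     ≡⟨ ∑-+ n (λ y → 𝟙 (K 0 y ≟ᶠ 0F))
                          (λ y → 𝟙 (K 0 y ≟ᶠ 1F) + 𝟙 (K 0 y ≟ᶠ 2F)) ⟩
    row-count 0F + ∑ n (λ y → 𝟙 (K 0 y ≟ᶠ 1F) + 𝟙 (K 0 y ≟ᶠ 2F))
                     ≡⟨ cong (row-count 0F +_) (∑-+ n (λ y → 𝟙 (K 0 y ≟ᶠ 1F))
                                                 (λ y → 𝟙 (K 0 y ≟ᶠ 2F))) ⟩
    row-count 0F + (row-count 1F + row-count 2F) ∎
    where
    open ≤-Reasoning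
    one : (c : Fin 3) → 1 ≤ 𝟙 (c ≟ᶠ 0F) + (𝟙 (c ≟ᶠ 1F) + 𝟙 (c ≟ᶠ 2F))
    one 0F = s≤s z≤n
    one 1F = s≤s z≤n
    one 2F = s≤s z≤n

  majority-color : ∀ m → 3 * m < n →
    ∃[ ρ ] ∃[ β ] ∃[ γ ] (Covers ρ β γ × m < row-count ρ)
  majority-color m 3m<n with m <? row-count 0F | m <? row-count 1F | m <? row-count 2F
  ... | yes p | _     | _     = 0F , 1F , 2F , cover , p
    where
    cover : Covers {3} 0F 1F 2F
    cover 0F = inj₁ refl
    cover 1F = inj₂ (inj₁ refl)
    cover 2F = inj₂ (inj₂ refl)
  ... | no _  | yes p | _     = 1F , 0F , 2F , cover , p
    where
    cover : Covers {3} 1F 0F 2F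
    cover 0F = inj₂ (inj₁ refl)
    cover 1F = inj₁ refl
    cover 2F = inj₂ (inj₂ refl)
  ... | no _  | no _  | yes p = 2F , 0F , 1F , cover , p
    where
    cover : Covers {3} 2F 0F 1F
    cover 0F = inj₂ (inj₁ refl)
    cover 1F = inj₂ (inj₂ refl)
    cover 2F = inj₁ refl
  ... | no ¬p | no ¬q | no ¬r = contradiction (≤-trans 3m<n (≤-trans row-counts
          (≤-trans (+-mono-≤ (≮⇒≥ ¬p) (+-mono-≤ (≮⇒≥ ¬q) (≮⇒≥ ¬r)))
            (≤-reflexive (triple m))))) (<-irrefl refl)
    where
    triple : ∀ m → m + (m + m) ≡ 3 * m
    triple = solve-∀

-- Decidability of forcing an L.

monochromaticL? : ∀ {k n} (χ : Coloring k n) → Dec (MonochromaticL χ)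
monochromaticL? χ = map′ to from
  -- Only the four coordinates range over finite sets; `d` is recovered as `toℕ x′ ∸ toℕ x`.
  (any? λ x → any? λ y → any? λ x′ → any? λ y′ →
    (toℕ x <? toℕ x′) ×-dec (toℕ y′ ≟ toℕ y + (toℕ x′ ∸ toℕ x)) ×-dec
    (χ (x , y) ≟ᶠ χ (x′ , y)) ×-dec (χ (x′ , y) ≟ᶠ χ (x′ , y′)))
  where
  Corners : Set
  Corners = ∃[ x ] ∃[ y ] ∃[ x′ ] ∃[ y′ ]
    (toℕ x < toℕ x′ × toℕ y′ ≡ toℕ y + (toℕ x′ ∸ toℕ x) ×
     χ (x , y) ≡ χ (x′ , y) × χ (x′ , y) ≡ χ (x′ , y′))
  to : Corners → MonochromaticL χ
  to (x , y , x′ , y′ , x<x′ , eq , c , c′) = record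
    { x = x ; y = y ; x′ = x′ ; y′ = y′ ; d = toℕ x′ ∸ toℕ x
    ; d>0 = m<n⇒0<n∸m x<x′ ; x′≡x+d = sym (m+[n∸m]≡n (<⇒≤ x<x′)) ; y′≡y+d = eq
    ; color₁₂ = c ; color₂₃ = c′ }
  from : MonochromaticL χ → Corners
  from l = x , y , x′ , y′
    , subst (toℕ x <_) (sym x′≡x+d) (m<m+n (toℕ x) d>0)
    , trans y′≡y+d (cong (toℕ y +_)
        (sym (trans (cong (_∸ toℕ x) x′≡x+d) (m+n∸m≡n (toℕ x) d))))
    , color₁₂ , color₂₃
    where open MonochromaticL l

monochromaticL-resp : ∀ {k n} {χ ψ : Coloring k n} → (∀ p → χ p ≡ ψ p) →
  MonochromaticL χ → MonochromaticL ψ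
monochromaticL-resp χ≡ψ l = record
  { x = x ; y = y ; x′ = x′ ; y′ = y′ ; d = d
  ; d>0 = d>0 ; x′≡x+d = x′≡x+d ; y′≡y+d = y′≡y+d
  ; color₁₂ = trans (sym (χ≡ψ _)) (trans color₁₂ (χ≡ψ _))
  ; color₂₃ = trans (sym (χ≡ψ _)) (trans color₂₃ (χ≡ψ _)) }
  where open MonochromaticL l

decode : ∀ {k n} → Fin (k ^ (n * n)) → Coloring k n
decode i = finToFun i ∘ uncurry combine

encode : ∀ {k n} → Coloring k n → Fin (k ^ (n * n))
encode {n = n} χ = funToFin (χ ∘ remQuot n)

decode-encode : ∀ {k n} (χ : Coloring k n) p → decode (encode χ) p ≡ χ p
decode-encode {n = n} χ (i , j) = trans (finToFun-funToFin (χ ∘ remQuot n) (combine i j))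
  (cong χ (remQuot-combine i j))

-- Numbering the colorings makes the quantifier over them finite. Decoding agrees with the original
-- coloring pointwise, which suffices by `monochromaticL-resp`.
forcesL? : ∀ k n → Dec (ForcesL k n)
forcesL? k n = map′
  (λ all χ → monochromaticL-resp (decode-encode χ) (all (encode χ)))
  (λ forces i → forces (decode i))
  (all? λ i → monochromaticL? (decode {k} {n} i))

-- Passing from rows to heights.

module _ {k N : ℕ} (χ : Coloring k (suc N)) where

  toℕ-mod : ∀ {m} → m < suc N → toℕ (m mod suc N) ≡ m
  toℕ-mod {m} m<n = trans (toℕ-fromℕ< (m%n<n m (suc N))) (m<n⇒m%n≡m m<n)

  -- Outside the grid the values are junk.
  byHeight : ℕ → ℕ → Fin k
  byHeight h y = χ ((N ∸ h) mod suc N , y mod suc N)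

  -- Rows are counted downward, so the higher cell is the first point of the L and the lower one its
  -- corner.
  byHeight-L : ∀ h y d → h + suc d < suc N → y + suc d < suc N →
    byHeight (h + suc d) y ≡ byHeight h y → byHeight h y ≡ byHeight h (y + suc d) →
    MonochromaticL χ
  byHeight-L h y d h<n y<n c c′ = record
    { x = (N ∸ (h + suc d)) mod suc N ; y = y mod suc N
    ; x′ = (N ∸ h) mod suc N ; y′ = (y + suc d) mod suc N
    ; d = suc d ; d>0 = z<s
    ; x′≡x+d = begin
        toℕ ((N ∸ h) mod suc N)                      ≡⟨ toℕ-mod (s≤s (m∸n≤m N h)) ⟩
        N ∸ h                                        ≡⟨ m∸n+n≡m (m+n≤o⇒m≤o∸n (suc d)
                                                          (subst (_≤ N) (+-comm h (suc d)) (s≤s⁻¹ h<n))) ⟨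
        N ∸ h ∸ suc d + suc d                        ≡⟨ cong (_+ suc d) (∸-+-assoc N h (suc d)) ⟩
        N ∸ (h + suc d) + suc d                      ≡⟨ cong (_+ suc d) (toℕ-mod (s≤s (m∸n≤m N (h + suc d)))) ⟨
        toℕ ((N ∸ (h + suc d)) mod suc N) + suc d    ∎
    ; y′≡y+d = trans (toℕ-mod y<n) (cong (_+ suc d) (sym (toℕ-mod (≤-<-trans (m≤m+n y (suc d)) y<n))))
    ; color₁₂ = c ; color₂₃ = c′ }
    where open ≡-Reasoning

-- Uses a color class of size r > m, so that c r² − c r ≥ c (m + 1) m.
forcesL-criterion : ∀ c m N → let n = suc N in 3 * m < n →
  2 * (n * n) + n * (2 * (c * (c + 1))) < c * (suc m * m) + 2 * n → ForcesL 3 n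
forcesL-criterion c m N 3m<n large χ =
  -- Decidability makes the argument by contradiction constructive.
  decidable-stable (monochromaticL? χ) λ ¬L →
    let ρ , _ , _ , cover , m<r = majority-color {suc N} (byHeight χ) m 3m<n
        module W = NoL {n = suc N} (byHeight χ)
          (λ h y d h<n y<n p q → ¬L (byHeight-L χ h y d h<n y<n p q))
    in <-irrefl refl (<-≤-trans large
         (excess m<r (W.bottom-square-≤ cover c)))
  where
  excess : ∀ {r X Y} → m < r → c * (r * r) + Y ≤ c * r + X → c * (suc m * m) + Y ≤ X
  excess {r} {X} {Y} m<r le with t , refl ← m≤n⇒∃[o]m+o≡n m<r =
    +-cancelˡ-≤ (c * (suc m + t)) _ _ (begin
      c * (suc m + t) + (c * (suc m * m) + Y)
        -- For `r = suc m + t`, the excess of `r (r − 1)` over `(m + 1) m` is `t (t + 2 m + 1)`.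
        ≤⟨ m≤m+n _ (c * (t * (t + suc m + m))) ⟩
      c * (suc m + t) + (c * (suc m * m) + Y) + c * (t * (t + suc m + m))
        ≡⟨ square c m t Y ⟩
      c * ((suc m + t) * (suc m + t)) + Y
        ≤⟨ le ⟩
      c * (suc m + t) + X ∎)
    where
    open ≤-Reasoning
    square : ∀ c m t Y →
      c * (suc m + t) + (c * (suc m * m) + Y) + c * (t * (t + suc m + m)) ≡
      c * ((suc m + t) * (suc m + t)) + Y
    square = solve-∀

-- The least forcing size and the bound 1804.

least : {P : ℕ → Set} → (∀ i → Dec (P i)) → ∀ n → P n →
  ∃[ m ] (P m × m ≤ n × (∀ i → P i → m ≤ i))
least P? zero    p = 0 , p , z≤n , λ _ _ → z≤n
least P? (suc n) p with P? 0
... | yes p₀ = 0 , p₀ , z≤n , λ _ _ → z≤n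
... | no ¬p₀ with m , pₘ , m≤n , min ← least (P? ∘ suc) n p =
  suc m , pₘ , s≤s m≤n , λ where
    zero    p₀ → contradiction p₀ ¬p₀
    (suc i) pᵢ → s≤s (min i pᵢ)

forcesL-1804 : ForcesL 3 1804
-- 601 is the largest `m` with `3 * m < 1804`. The second inequality evaluates to 13024880 <
-- 15199292.
forcesL-1804 = forcesL-criterion 42 601 1803 (≤ᵇ⇒≤ _ _ _) (≤ᵇ⇒≤ _ _ _)

least-forcing : ∀ k n → ForcesL k (suc n) → ∃[ r ] (IsR k r × r ≤ suc n)
least-forcing k n f =
  -- The index `i` stands for the size `suc i`, so the minimum is over positive sizes.
  let m , forces , m≤n , min = least {P = λ i → ForcesL k (suc i)} (λ i → forcesL? k (suc i)) n f
  in suc m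
   , record { positive = z<s ; forces = forces
            ; least = λ where (suc i) _ g → s≤s (min i g) }
   , s≤s m≤n

theorem3 : ∃[ r ] (IsR 3 r × r ≤ 1804)
theorem3 = least-forcing 3 1803 forcesL-1804
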